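{- Let $M$ be a multi-path matroid that is not a lattice path matroid. Then $M$ has a spanning circuit; moreover, every element of $M$ lies in some spanning circuit of $M$.
   Context: Transversal matroid $M[\mathcal{A}]$ of a multiset $\mathcal{A}=(A_j:j\in J)$ of subsets of a finite set $S$: independent sets are the sets $\{x_k:k\in K\}$ of $|K|$ distinct elements with $K\subseteq J$, $x_k\in A_k$. For a cyclic permutation $\sigma$ of $S$, a $\sigma$-interval is a nonempty set $\{f,\sigma(f),\ldots,l\}$. A multi-path matroid is a transversal matroid with a presentation by an antichain (no member containing another) of $\sigma$-intervals for some cyclic permutation $\sigma$ of the ground set. A lattice path matroid is a matroid isomorphic to $M[P,Q]$ for lattice paths $P,Q$ from $(0,0)$ to $(m,r)$ with $P$ never above $Q$, where $M[P,Q]$ is the transversal matroid on $[m+r]$ presented by $(N_1,\ldots,N_r)$, $N_i$ being the set of $j$ such that the $j$-th step of some lattice path from $(0,0)$ to $(m,r)$ staying weakly between $P$ and $Q$ is its $i$-th North step. A spanning circuit is a circuit whose closure is the whole ground set. -}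

module Defs where

open import Data.Nat using (ℕ; zero; suc; _+_; _≤_)
open import Data.Bool using (Bool; true; false; if_then_else_)
open import Data.Fin using (Fin; toℕ)
open import Data.Fin.Subset using (Subset; _∈_; _∉_; _⊆_; _⊂_; _∪_; ⁅_⁆; ∣_∣)
open import Data.Fin.Permutation using (Permutation′; _⟨$⟩ʳ_)
open import Data.Vec using (Vec; []; _∷_; lookup; tabulate)
open import Data.Product using (Σ; ∃; _×_; _,_)
open import Relation.Nullary using (¬_)
open import Relation.Binary.PropositionalEquality using (_≡_; _≢_)
open import Function.Bundles using (_↔_; Inverse)

IndepPred : ℕ → Set₁
IndepPred n = Subset n → Set

-- Transversal matroid M[A] of a family A = (A_j : j ∈ Fin k) of subsets
-- of Fin n (members given as predicates, so repetitions are allowed).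
-- X is independent iff there is an injective choice of indices
-- f : X → Fin k with x ∈ A_(f x) (a partial transversal).
TIndep : ∀ {n k} → (Fin k → Fin n → Set) → IndepPred n
TIndep {n} {k} A X =
  Σ ((x : Fin n) → x ∈ X → Fin k) λ f →
    ((x : Fin n) (p : x ∈ X) → A (f x p) x) ×
    ((x y : Fin n) (p : x ∈ X) (q : y ∈ X) → f x p ≡ f y q → x ≡ y)

HasRank : ∀ {n} → IndepPred n → Subset n → ℕ → Set
HasRank I X ρ =
  (Σ _ λ Y → Y ⊆ X × I Y × ∣ Y ∣ ≡ ρ) ×
  (∀ Y → Y ⊆ X → I Y → ∣ Y ∣ ≤ ρ)

InClosure : ∀ {n} → IndepPred n → Subset n → Fin n → Set
InClosure I X x = ∃ λ ρ → HasRank I X ρ × HasRank I (X ∪ ⁅ x ⁆) ρ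

IsCircuit : ∀ {n} → IndepPred n → Subset n → Set
IsCircuit I C = ¬ I C × (∀ Y → Y ⊂ C → I Y)

IsSpanningCircuit : ∀ {n} → IndepPred n → Subset n → Set
IsSpanningCircuit I C = IsCircuit I C × (∀ x → InClosure I C x)

preimage : ∀ {n n'} → (Fin n ↔ Fin n') → Subset n' → Subset n
preimage e Y = tabulate (λ x → lookup Y (Inverse.to e x))

Isomorphic : ∀ {n n'} → IndepPred n → IndepPred n' → Set
Isomorphic {n} {n'} I J =
  Σ (Fin n ↔ Fin n') λ e →
    ∀ (Y : Subset n') → (I (preimage e Y) → J Y) × (J Y → I (preimage e Y))

iter : ∀ {n} → Permutation′ n → ℕ → Fin n → Fin n
iter σ zero x = x
iter σ (suc i) x = σ ⟨$⟩ʳ (iter σ i x)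

IsCyclic : ∀ {n} → Permutation′ n → Set
IsCyclic {n} σ = ∀ (x y : Fin n) → ∃ λ i → iter σ i x ≡ y

-- I is a σ-interval: I = {f, σ f, …, σ^t f} (nonempty by construction)
IsInterval : ∀ {n} → Permutation′ n → Subset n → Set
IsInterval {n} σ I =
  Σ (Fin n) λ f → Σ ℕ λ t →
    ∀ (x : Fin n) → (x ∈ I → ∃ λ i → i ≤ t × iter σ i f ≡ x) ×
                    ((∃ λ i → i ≤ t × iter σ i f ≡ x) → x ∈ I)

IsAntichain : ∀ {n k} → (Fin k → Subset n) → Set
IsAntichain {n} {k} B = ∀ (i j : Fin k) → i ≢ j → ¬ (B i ⊆ B j)

IsMultiPathPresentation : ∀ {n k} → (Fin k → Subset n) → Set
IsMultiPathPresentation {n} B =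
  Σ (Permutation′ n) λ σ → IsCyclic σ × (∀ j → IsInterval σ (B j)) × IsAntichain B

TIndepS : ∀ {n k} → (Fin k → Subset n) → IndepPred n
TIndepS B = TIndep (λ j x → x ∈ B j)

IsMultiPath : ∀ {n} → IndepPred n → Set
IsMultiPath {n} I =
  Σ ℕ λ k → Σ (Fin k → Subset n) λ B →
    IsMultiPathPresentation B × (∀ X → (I X → TIndepS B X) × (TIndepS B X → I X))

-- Lattice paths and lattice path matroids.
-- A lattice path of length L is a Vec Bool L (true = North step,
-- false = East step).  northsIn p h = number of North steps among the
-- first h steps of p.

northsIn : ∀ {L} → Vec Bool L → ℕ → ℕ
northsIn [] h = 0
northsIn (b ∷ bs) zero = 0
northsIn (b ∷ bs) (suc h) = (if b then 1 else 0) + northsIn bs h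

-- lattice path from (0,0) to (m,r)
IsLatticePath : (m r : ℕ) → Vec Bool (m + r) → Set
IsLatticePath m r P = northsIn P (m + r) ≡ r

NeverAbove : ∀ {L} → Vec Bool L → Vec Bool L → Set
NeverAbove P Q = ∀ h → northsIn P h ≤ northsIn Q h

-- N_i (i = toℕ i + 1 in 1-based indexing): the steps j (0-based here)
-- that are the i-th North step of some lattice path weakly between P and Q
NSet : (m r : ℕ) → Vec Bool (m + r) → Vec Bool (m + r) → Fin r → Fin (m + r) → Set
NSet m r P Q i j =
  Σ (Vec Bool (m + r)) λ R →
    IsLatticePath m r R × NeverAbove P R × NeverAbove R Q ×
    lookup R j ≡ true × northsIn R (toℕ j) ≡ toℕ i

LPMIndep : (m r : ℕ) → Vec Bool (m + r) → Vec Bool (m + r) → IndepPred (m + r)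
LPMIndep m r P Q = TIndep (NSet m r P Q)

IsLatticePathMatroid : ∀ {n} → IndepPred n → Set
IsLatticePathMatroid I =
  Σ ℕ λ m → Σ ℕ λ r → Σ (Vec Bool (m + r)) λ P → Σ (Vec Bool (m + r)) λ Q →
    IsLatticePath m r P × IsLatticePath m r Q × NeverAbove P Q ×
    Isomorphic I (LPMIndep m r P Q)

{-# OPTIONS --safe #-}
module Submission where

-- Call g a cut if no interval contains g other than as its first element. If there is a cut g,
-- the intervals are linear in the order starting at g, and the matroid is a lattice path matroid.
-- Otherwise, let F be the set of the k first elements, one for each interval; it is a basis.
-- Since no first element is a cut, the antichain condition forces each first element to lie
-- also in the interval starting at the preceding one. So the intervals act as the edges of a
-- cycle through F, and adding any y ∉ F gives a circuit of size k + 1: deleting an element of F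
-- opens the cycle, and the remaining elements can be matched to the intervals so that one
-- containing y stays free. If F is the whole ground set, the matroid is free, which is again
-- a lattice path matroid.

open import Defs
open import Data.Nat
  using (ℕ; zero; suc; pred; NonZero; _+_; _*_; _∸_; _≤_; _<_; _≤?_; _<?_; z≤n; s≤s; >-nonZero)
open import Data.Nat.Properties
open import Data.Nat.DivMod using (_%_; _/_; m≡m%n+[m/n]*n; m%n<n)
open import Data.Bool using (true; false)
open import Data.Fin using (Fin; zero; suc; toℕ; fromℕ<; punchOut)
import Data.Fin.Properties as Fin
open import Data.Fin.Permutation using (Permutation′; _⟨$⟩ʳ_; _⟨$⟩ˡ_; inverseˡ)
open import Data.Fin.Subset using (Subset; _∈_; _∉_; _⊆_; _⊂_; _∪_; ⁅_⁆; ∣_∣; inside; outside; ⊤; ⊥)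
open import Data.Fin.Subset.Properties
  using (_∈?_; ∈⊤; ∣⊤∣≡n; ∣⊥∣≡0; p⊆q⇒∣p∣≤∣q∣; p⊂q⇒∣p∣<∣q∣; p⊆p∪q; drop-there)
open import Data.Vec using (Vec; []; _∷_; lookup; tabulate; here; there)
open import Data.Vec.Properties using (lookup∘tabulate; lookup⇒[]=; []=⇒lookup)
open import Data.Product using (Σ; ∃; _×_; _,_; proj₁; proj₂)
open import Data.Sum using (_⊎_; inj₁; inj₂; [_,_]′)
open import Function using (_∘_; id)
open import Function.Bundles using (_↔_; Inverse; mk↔ₛ′)
open import Function.Construct.Identity using (↔-id)
open import Function.Definitions using (Injective)
open import Relation.Nullary using (¬_; yes; no; does; contradiction)
open import Relation.Nullary.Decidable using (dec-true; _×-dec_; _⊎-dec_; ¬?; decidable-stable)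
open import Relation.Unary using (Pred; Decidable)
open import Relation.Binary.Definitions using (tri<; tri≈; tri>)
open import Relation.Binary.PropositionalEquality
  using (_≡_; _≢_; refl; sym; trans; cong; subst; subst₂)
open import Level using (0ℓ)

-- Finite subsets

index : ∀ {n} {X : Subset n} {x} → x ∈ X → Fin ∣ X ∣
index here = zero
index {X = inside ∷ _} (there p) = suc (index p)
index {X = outside ∷ _} (there p) = index p

index-injective : ∀ {n} {X : Subset n} {x y} (p : x ∈ X) (q : y ∈ X) → index p ≡ index q → x ≡ y
index-injective here here _ = refl
index-injective {X = inside ∷ _} (there p) (there q) e = cong suc (index-injective p q (Fin.suc-injective e))
index-injective {X = outside ∷ _} (there p) (there q) e = cong suc (index-injective p q e)
index-injective {X = inside ∷ _} here (there q) ()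
index-injective {X = inside ∷ _} (there p) here ()

element : ∀ {n} (X : Subset n) → Fin ∣ X ∣ → Fin n
element (inside ∷ X) zero = zero
element (inside ∷ X) (suc i) = suc (element X i)
element (outside ∷ X) i = suc (element X i)

element-∈ : ∀ {n} (X : Subset n) i → element X i ∈ X
element-∈ (inside ∷ X) zero = here
element-∈ (inside ∷ X) (suc i) = there (element-∈ X i)
element-∈ (outside ∷ X) i = there (element-∈ X i)

element-injective : ∀ {n} (X : Subset n) → Injective _≡_ _≡_ (element X)
element-injective (inside ∷ X) {zero} {zero} _ = refl
element-injective (inside ∷ X) {suc i} {suc j} e = cong suc (element-injective X (Fin.suc-injective e))
element-injective (outside ∷ X) e = element-injective X (Fin.suc-injective e)

-- Enumerating `X` by `element` and ranking within `Y` by `index` turns `h` into an injection from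
-- `Fin ∣ X ∣` to `Fin ∣ Y ∣`. Like the matchings in `TIndep`, `h` may depend on the membership
-- proof.
∣∣-injective⇒≤ : ∀ {n k} {X : Subset n} {Y : Subset k} (h : ∀ x → x ∈ X → Fin k) →
  (∀ x p → h x p ∈ Y) → (∀ x y p q → h x p ≡ h y q → x ≡ y) → ∣ X ∣ ≤ ∣ Y ∣
∣∣-injective⇒≤ {X = X} h h∈ inj =
  Fin.injective⇒≤ {f = λ i → index (h∈ (element X i) (element-∈ X i))}
    (λ e → element-injective X (inj _ _ _ _
      (index-injective (h∈ _ (element-∈ X _)) (h∈ _ (element-∈ X _)) e)))

toSubset : ∀ {n} {P : Pred (Fin n) 0ℓ} → Decidable P → Subset n
toSubset P? = tabulate (does ∘ P?)

∈-toSubset⁺ : ∀ {n} {P : Pred (Fin n) 0ℓ} (P? : Decidable P) {x} → P x → x ∈ toSubset P?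
∈-toSubset⁺ P? {x} px = lookup⇒[]= x _ (trans (lookup∘tabulate (does ∘ P?) x) (dec-true (P? x) px))

∈-toSubset⁻ : ∀ {n} {P : Pred (Fin n) 0ℓ} (P? : Decidable P) {x} → x ∈ toSubset P? → P x
∈-toSubset⁻ P? {x} x∈ with P? x | trans (sym (lookup∘tabulate (does ∘ P?) x)) ([]=⇒lookup x∈)
... | yes px | _ = px
... | no _ | ()

minimiser : ∀ {k} {P : Pred (Fin k) 0ℓ} → Decidable P → (m : Fin k → ℕ) → ∃ P →
  ∃ λ j → P j × ∀ i → P i → m j ≤ m i
-- Descent: each strictly better candidate lowers the bound `b` on the current value.
minimiser {k} {P} P? m (j , pj) = go (m j) j pj ≤-refl
  where
  go : ∀ b j → P j → m j ≤ b → ∃ λ j → P j × ∀ i → P i → m j ≤ m i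
  go b j pj mj≤b with Fin.any? (λ i → P? i ×-dec (m i <? m j))
  ... | no ∄ = j , pj , λ i pi → ≮⇒≥ (λ lt → ∄ (i , pi , lt))
  go zero j pj mj≤b | yes (i , pi , lt) = contradiction (<-≤-trans lt mj≤b) λ ()
  go (suc b) j pj mj≤b | yes (i , pi , lt) = go b i pi (≤-pred (<-≤-trans lt mj≤b))

-- Transversal matroids

-- A relation in place of a function lets a matching be given as an inductive family and its
-- injectivity be checked case against case.
TIndep-matching : ∀ {n k} (A : Fin k → Fin n → Set) {X : Subset n} (R : Fin n → Fin k → Set) →
  (∀ {x} → x ∈ X → ∃ (R x)) → (∀ {x j} → R x j → A j x) →
  (∀ {x y i j} → R x i → R y j → i ≡ j → x ≡ y) → TIndep A X
TIndep-matching A R total sound inj =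
  (λ x p → proj₁ (total p)) , (λ x p → sound (proj₂ (total p))) ,
  λ x y p q e → inj (proj₂ (total p)) (proj₂ (total q)) e

TIndep-map : ∀ {n n' k k'} {A : Fin k → Fin n → Set} {A' : Fin k' → Fin n' → Set} {X Y}
  (φ : Fin n' → Fin n) (ψ : Fin k → Fin k') → Injective _≡_ _≡_ φ → Injective _≡_ _≡_ ψ →
  (∀ {y} → y ∈ Y → φ y ∈ X) → (∀ {j y} → A j (φ y) → A' (ψ j) y) → TIndep A X → TIndep A' Y
TIndep-map φ ψ φ-inj ψ-inj Y→X A→A' (f , f∈ , f-inj) =
  (λ y p → ψ (f (φ y) (Y→X p))) , (λ y p → A→A' (f∈ _ _)) ,
  λ x y p q e → φ-inj (f-inj _ _ _ _ (ψ-inj e))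

TIndep-⊆ : ∀ {n k} (A : Fin k → Fin n → Set) {X Y} → Y ⊆ X → TIndep A X → TIndep A Y
TIndep-⊆ A Y⊆X = TIndep-map {A = A} id id id id Y⊆X id

TIndep⇒∣∣≤ : ∀ {n k} (A : Fin k → Fin n → Set) {X} → TIndep A X → ∣ X ∣ ≤ k
TIndep⇒∣∣≤ {k = k} A {X} (f , _ , f-inj) =
  subst (∣ X ∣ ≤_) (∣⊤∣≡n k) (∣∣-injective⇒≤ f (λ _ _ → ∈⊤) f-inj)

-- Lattice paths

northsIn-suc : ∀ {L} (v : Vec _ L) p → lookup v p ≡ true →
  northsIn v (suc (toℕ p)) ≡ suc (northsIn v (toℕ p))
northsIn-suc (true ∷ v) zero _ = cong suc (northsIn-zero v)
  where
  northsIn-zero : ∀ {L} (v : Vec _ L) → northsIn v 0 ≡ 0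
  northsIn-zero [] = refl
  northsIn-zero (_ ∷ _) = refl
northsIn-suc (true ∷ v) (suc p) e = cong suc (northsIn-suc v p e)
northsIn-suc (false ∷ v) (suc p) e = northsIn-suc v p e

norths<? : ∀ {L} (v : Vec _ L) (h : ℕ) → Decidable (λ p → p ∈ v × toℕ p < h)
norths<? v h p = (p ∈? v) ×-dec (toℕ p <? h)

∣∣-mono : ∀ {n} {P Q : Pred (Fin n) 0ℓ} (P? : Decidable P) (Q? : Decidable Q) →
  (∀ {x} → P x → Q x) → ∣ toSubset P? ∣ ≤ ∣ toSubset Q? ∣
∣∣-mono P? Q? P⇒Q = p⊆q⇒∣p∣≤∣q∣ (∈-toSubset⁺ Q? ∘ P⇒Q ∘ ∈-toSubset⁻ P?)

∣∣-none : ∀ {n} {P : Pred (Fin n) 0ℓ} (P? : Decidable P) → (∀ {x} → ¬ P x) → ∣ toSubset P? ∣ ≡ 0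
∣∣-none {n} P? none = n≤0⇒n≡0 (subst (∣ toSubset P? ∣ ≤_) (∣⊥∣≡0 n)
  (p⊆q⇒∣p∣≤∣q∣ {p = toSubset P?} {q = ⊥} (λ p → contradiction (∈-toSubset⁻ P? p) none)))

∣∣-cong : ∀ {n} {P Q : Pred (Fin n) 0ℓ} (P? : Decidable P) (Q? : Decidable Q) →
  (∀ {x} → P x → Q x) → (∀ {x} → Q x → P x) → ∣ toSubset P? ∣ ≡ ∣ toSubset Q? ∣
∣∣-cong P? Q? f g = ≤-antisym (∣∣-mono P? Q? f) (∣∣-mono Q? P? g)

-- Once North steps are counted by a cardinality, paths can be compared through inclusions and
-- injections.
northsIn-count : ∀ {L} (v : Vec _ L) h → northsIn v h ≡ ∣ toSubset (norths<? v h) ∣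
northsIn-count [] h = refl
northsIn-count (b ∷ v) zero = sym (∣∣-none (norths<? (b ∷ v) 0) (λ { (_ , ()) }))
northsIn-count (true ∷ v) (suc h) =
  cong suc (trans (northsIn-count v h) (∣∣-cong (norths<? v h) (norths<? (true ∷ v) (suc h) ∘ suc)
    (λ (p , l) → there p , s≤s l) (λ (p , l) → drop-there p , ≤-pred l)))
northsIn-count (false ∷ v) (suc h) =
  trans (northsIn-count v h) (∣∣-cong (norths<? v h) (norths<? (false ∷ v) (suc h) ∘ suc)
    (λ (p , l) → there p , s≤s l) (λ (p , l) → drop-there p , ≤-pred l))

below? : ∀ {k n} (c : Fin k → Fin n) (h : ℕ) → Decidable (λ i → toℕ (c i) < h)
below? c h i = toℕ (c i) <? h

cnt : ∀ {k n} → (Fin k → Fin n) → ℕ → ℕ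
cnt c h = ∣ toSubset (below? c h) ∣

hits? : ∀ {k n} (c : Fin k → Fin n) → Decidable (λ p → ∃ λ i → c i ≡ p)
hits? c p = Fin.any? (λ i → c i Fin.≟ p)

-- Subsets and lattice paths are both Boolean vectors; this one has its North steps at the values of
-- `c`.
path : ∀ {k n} → (Fin k → Fin n) → Subset n
path c = toSubset (hits? c)

northsIn-path : ∀ {k n} (c : Fin k → Fin n) → Injective _≡_ _≡_ c → ∀ h → northsIn (path c) h ≡ cnt c h
northsIn-path {k} {n} c c-inj h = trans (northsIn-count (path c) h) (≤-antisym
  (∣∣-injective⇒≤ (λ p q → proj₁ (hit p q))
    (λ p q → ∈-toSubset⁺ (below? c h) (subst (λ z → toℕ z < h) (sym (proj₂ (hit p q)))
      (proj₂ (∈-toSubset⁻ (norths<? (path c) h) q))))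
    (λ x y p q e → trans (sym (proj₂ (hit x p))) (trans (cong c e) (proj₂ (hit y q)))))
  (∣∣-injective⇒≤ (λ i _ → c i)
    (λ i q → ∈-toSubset⁺ (norths<? (path c) h) (∈-toSubset⁺ (hits? c) (i , refl) , ∈-toSubset⁻ (below? c h) q))
    (λ _ _ _ _ → c-inj)))
  where
  hit : ∀ p → p ∈ toSubset (norths<? (path c) h) → ∃ λ i → c i ≡ p
  hit p q = ∈-toSubset⁻ (hits? c) (proj₁ (∈-toSubset⁻ (norths<? (path c) h) q))

cnt-all : ∀ {k n} (c : Fin k → Fin n) → cnt c n ≡ k
cnt-all {k} {n} c = trans (≤-antisym (p⊆q⇒∣p∣≤∣q∣ {p = toSubset (below? c n)} {q = ⊤} (λ _ → ∈⊤))
  (p⊆q⇒∣p∣≤∣q∣ {p = ⊤} {q = toSubset (below? c n)}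
    (λ {i} _ → ∈-toSubset⁺ (below? c n) (Fin.toℕ<n (c i))))) (∣⊤∣≡n k)

cnt-strict : ∀ {k n} (c : Fin k → Fin n) {h h'} i → h ≤ toℕ (c i) → toℕ (c i) < h' → cnt c h < cnt c h'
cnt-strict c {h} {h'} i h≤ <h' = p⊂q⇒∣p∣<∣q∣
  {p = toSubset (below? c h)} {q = toSubset (below? c h')}
  ((λ p → ∈-toSubset⁺ (below? c h') (<-trans (<-≤-trans (∈-toSubset⁻ (below? c h) p) h≤) <h')) ,
   i , ∈-toSubset⁺ (below? c h') <h' , λ p → <⇒≱ (∈-toSubset⁻ (below? c h) p) h≤)

cnt-mono : ∀ {k n} (c : Fin k → Fin n) {h h'} → h ≤ h' → cnt c h ≤ cnt c h'
cnt-mono c h≤h' = ∣∣-mono (below? c _) (below? c _) (λ p → <-≤-trans p h≤h')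

cnt-antitone : ∀ {k n} (c d : Fin k → Fin n) → (∀ i → toℕ (c i) ≤ toℕ (d i)) → ∀ h → cnt d h ≤ cnt c h
cnt-antitone c d c≤d h = ∣∣-mono (below? d h) (below? c h) (λ {i} p → ≤-<-trans (c≤d i) p)

path-isLatticePath : ∀ {m k} (c : Fin k → Fin (m + k)) → Injective _≡_ _≡_ c → IsLatticePath m k (path c)
path-isLatticePath {m} {k} c c-inj = trans (northsIn-path c c-inj (m + k)) (cnt-all c)

path-neverAbove : ∀ {k n} (c d : Fin k → Fin n) → Injective _≡_ _≡_ c → Injective _≡_ _≡_ d →
  (∀ i → toℕ (c i) ≤ toℕ (d i)) → NeverAbove (path d) (path c)
path-neverAbove c d c-inj d-inj c≤d h =
  subst₂ _≤_ (sym (northsIn-path d d-inj h)) (sym (northsIn-path c c-inj h)) (cnt-antitone c d c≤d h)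

-- The family of intervals [a j , b j] is sorted by its left ends, which is also its order by
-- right ends; the j-th interval is then NSet of the paths with North steps at the b i
-- (lower path) and at the a i (upper path).
module IntervalFamily {n k} (a b : Fin k → Fin n) (a≤b : ∀ i → toℕ (a i) ≤ toℕ (b i))
  (b-mono : ∀ {i j} → i ≢ j → toℕ (a i) ≤ toℕ (a j) → toℕ (b i) < toℕ (b j)) where

  P Q : Subset n
  P = path b
  Q = path a

  a<⇒≢ : ∀ {i j} → toℕ (a i) < toℕ (a j) → i ≢ j
  a<⇒≢ lt refl = <-irrefl refl lt

  a<⇒b< : ∀ {i j} → toℕ (a i) < toℕ (a j) → toℕ (b i) < toℕ (b j)
  a<⇒b< lt = b-mono (a<⇒≢ lt) (<⇒≤ lt)

  b<⇒a< : ∀ {i j} → toℕ (b i) < toℕ (b j) → toℕ (a i) < toℕ (a j)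
  b<⇒a< {i} {j} lt = ≰⇒> λ le → <-asym lt (b-mono (λ { refl → <-irrefl refl lt }) le)

  -- Distinct intervals cannot share a left end, since `b-mono` would then order their right ends
  -- strictly both ways.
  a-compare : ∀ i j → toℕ (a i) < toℕ (a j) ⊎ i ≡ j ⊎ toℕ (a j) < toℕ (a i)
  a-compare i j with <-cmp (toℕ (a i)) (toℕ (a j))
  ... | tri< lt _ _ = inj₁ lt
  ... | tri> _ _ gt = inj₂ (inj₂ gt)
  ... | tri≈ _ e _ with i Fin.≟ j
  ...   | yes i≡j = inj₂ (inj₁ i≡j)
  ...   | no i≢j = contradiction (b-mono i≢j (≤-reflexive e))
                     (<-asym (b-mono (i≢j ∘ sym) (≤-reflexive (sym e))))

  monotone⇒injective : (c : Fin k → Fin n) →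
    (∀ {i j} → toℕ (a i) < toℕ (a j) → toℕ (c i) < toℕ (c j)) → Injective _≡_ _≡_ c
  monotone⇒injective c mono {i} {j} e with a-compare i j
  ... | inj₁ lt = contradiction (mono lt) (<-irrefl (cong toℕ e))
  ... | inj₂ (inj₁ i≡j) = i≡j
  ... | inj₂ (inj₂ gt) = contradiction (mono gt) (<-irrefl (cong toℕ (sym e)))

  a-injective : Injective _≡_ _≡_ a
  a-injective = monotone⇒injective a id

  b-injective : Injective _≡_ _≡_ b
  b-injective = monotone⇒injective b a<⇒b<

  northsIn-P : ∀ h → northsIn P h ≡ cnt b h
  northsIn-P = northsIn-path b b-injective

  northsIn-Q : ∀ h → northsIn Q h ≡ cnt a h
  northsIn-Q = northsIn-path a a-injective

  cnt-a<k : ∀ j → cnt a (toℕ (a j)) < k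
  cnt-a<k j = subst (cnt a (toℕ (a j)) <_) (cnt-all a) (cnt-strict a j ≤-refl (Fin.toℕ<n (a j)))

  -- The family need not be indexed in order; this is the place of interval `j` in the order by left
  -- ends.
  rank : Fin k → Fin k
  rank j = fromℕ< (cnt-a<k j)

  toℕ-rank : ∀ j → toℕ (rank j) ≡ cnt a (toℕ (a j))
  toℕ-rank j = Fin.toℕ-fromℕ< (cnt-a<k j)

  rank-mono : ∀ {i j} → toℕ (a i) < toℕ (a j) → toℕ (rank i) < toℕ (rank j)
  rank-mono {i} {j} lt = subst₂ _<_ (sym (toℕ-rank i)) (sym (toℕ-rank j)) (cnt-strict a i ≤-refl lt)

  rank-injective : Injective _≡_ _≡_ rank
  rank-injective {i} {j} e with a-compare i j
  ... | inj₁ lt = contradiction (rank-mono lt) (<-irrefl (cong toℕ e))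
  ... | inj₂ (inj₁ i≡j) = i≡j
  ... | inj₂ (inj₂ gt) = contradiction (rank-mono gt) (<-irrefl (cong toℕ (sym e)))

  -- Left and right ends are ordered alike, so the intervals ending before interval `j` ends are
  -- those starting before it starts.
  cnt-b≡rank : ∀ j → cnt b (toℕ (b j)) ≡ toℕ (rank j)
  cnt-b≡rank j = trans (∣∣-cong (below? b _) (below? a _) b<⇒a< a<⇒b<) (sym (toℕ-rank j))

  -- Follow the upper path before its j-th North step, step North at p, then follow the lower path.
  module Detour (j : Fin k) (p : Fin n) (a≤p : toℕ (a j) ≤ toℕ p) (p≤b : toℕ p ≤ toℕ (b j)) where

    data Cases (i : Fin k) : Fin n → Set where
      before : toℕ (a i) < toℕ (a j) → Cases i (a i)
      at     : i ≡ j → Cases i p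
      after  : toℕ (a j) < toℕ (a i) → Cases i (b i)

    cases : ∀ i → ∃ (Cases i)
    cases i with a-compare i j
    ... | inj₁ lt = _ , before lt
    ... | inj₂ (inj₁ e) = _ , at e
    ... | inj₂ (inj₂ gt) = _ , after gt

    c : Fin k → Fin n
    c i = proj₁ (cases i)

    c-mono : ∀ {i i'} → toℕ (a i) < toℕ (a i') → toℕ (c i) < toℕ (c i')
    c-mono {i} {i'} lt = go (proj₂ (cases i)) (proj₂ (cases i'))
      where
      go : ∀ {x y} → Cases i x → Cases i' y → toℕ x < toℕ y
      go (before _) (before _) = lt
      go (before u) (at refl) = <-≤-trans u a≤p
      go (before _) (after _) = <-≤-trans lt (a≤b i')
      go (at refl) (before v) = contradiction v (<-asym lt)
      go (at refl) (at refl) = contradiction lt (<-irrefl refl)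
      go (at refl) (after v) = ≤-<-trans p≤b (a<⇒b< v)
      go (after u) (before v) = contradiction lt (<-asym (<-trans v u))
      go (after u) (at refl) = contradiction lt (<-asym u)
      go (after _) (after _) = a<⇒b< lt

    c-injective : Injective _≡_ _≡_ c
    c-injective = monotone⇒injective c c-mono

    a≤c : ∀ i → toℕ (a i) ≤ toℕ (c i)
    a≤c i with cases i
    ... | _ , before _ = ≤-refl
    ... | _ , at refl = a≤p
    ... | _ , after _ = a≤b i

    c≤b : ∀ i → toℕ (c i) ≤ toℕ (b i)
    c≤b i with cases i
    ... | _ , before _ = a≤b i
    ... | _ , at refl = p≤b
    ... | _ , after _ = ≤-refl

    -- With its converse `a<⇒c<p`, this shows that exactly `rank j` North steps of the detour
    -- precede `p`.
    c<p⇒a< : ∀ {i} → toℕ (c i) < toℕ p → toℕ (a i) < toℕ (a j)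
    c<p⇒a< {i} lt with cases i
    ... | _ , before u = u
    ... | _ , at refl = contradiction lt (<-irrefl refl)
    ... | _ , after u = contradiction (≤-<-trans p≤b (a<⇒b< u)) (<-asym lt)

    a<⇒c<p : ∀ {i} → toℕ (a i) < toℕ (a j) → toℕ (c i) < toℕ p
    a<⇒c<p {i} lt with cases i
    ... | _ , before u = <-≤-trans u a≤p
    ... | _ , at refl = contradiction lt (<-irrefl refl)
    ... | _ , after u = contradiction lt (<-asym u)

    cj≡p : c j ≡ p
    cj≡p with cases j
    ... | _ , before u = contradiction u (<-irrefl refl)
    ... | _ , at _ = refl
    ... | _ , after u = contradiction u (<-irrefl refl)

module LatticePathPresentation {m k} (a b : Fin k → Fin (m + k)) (a≤b : ∀ i → toℕ (a i) ≤ toℕ (b i))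
  (b-mono : ∀ {i j} → i ≢ j → toℕ (a i) ≤ toℕ (a j) → toℕ (b i) < toℕ (b j)) where

  open IntervalFamily a b a≤b b-mono public

  -- If `p` came before `a j`, then `R` would have `rank j + 1` North steps just after `p`, more
  -- than the upper path. If `p` came after `b j`, the lower path would have more than `rank j`
  -- North steps before `p`, and `R` only `rank j`.
  NSet⇒∈ : ∀ {j p} → NSet m k P Q (rank j) p → toℕ (a j) ≤ toℕ p × toℕ p ≤ toℕ (b j)
  NSet⇒∈ {j} {p} (R , _ , P≤R , R≤Q , Rp , count) =
    ≮⇒≥ (λ p<a → <⇒≱ (begin-strict
        toℕ (rank j)                  <⟨ n<1+n _ ⟩
        suc (toℕ (rank j))            ≡⟨ cong suc count ⟨
        suc (northsIn R (toℕ p))      ≡⟨ northsIn-suc R p Rp ⟨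
        northsIn R (suc (toℕ p))      ≤⟨ R≤Q (suc (toℕ p)) ⟩
        northsIn Q (suc (toℕ p))      ≡⟨ northsIn-Q _ ⟩
        cnt a (suc (toℕ p))           ∎)
      (≤-trans (cnt-mono a p<a) (≤-reflexive (sym (toℕ-rank j))))) ,
    ≮⇒≥ (λ b<p → <⇒≱ (begin-strict
        cnt b (toℕ (b j))             <⟨ cnt-strict b j ≤-refl b<p ⟩
        cnt b (toℕ p)                 ≡⟨ northsIn-P _ ⟨
        northsIn P (toℕ p)            ≤⟨ P≤R (toℕ p) ⟩
        northsIn R (toℕ p)            ≡⟨ count ⟩
        toℕ (rank j)                  ∎)
      (≤-reflexive (sym (cnt-b≡rank j))))
    where open ≤-Reasoning

  ∈⇒NSet : ∀ {j p} → toℕ (a j) ≤ toℕ p × toℕ p ≤ toℕ (b j) → NSet m k P Q (rank j) p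
  ∈⇒NSet {j} {p} (a≤p , p≤b) =
    path c , path-isLatticePath c c-injective ,
    path-neverAbove c b c-injective (b-injective) c≤b ,
    path-neverAbove a c (a-injective) c-injective a≤c ,
    []=⇒lookup (∈-toSubset⁺ (hits? c) (j , cj≡p)) ,
    trans (northsIn-path c c-injective (toℕ p))
      (trans (∣∣-cong (below? c _) (below? a _) c<p⇒a< a<⇒c<p) (sym (toℕ-rank j)))
    where open Detour j p a≤p p≤b

-- Matroids presented by intervals of a linear order

injective⇒surjective : ∀ {k} (f : Fin k → Fin k) → Injective _≡_ _≡_ f → ∀ x → ∃ λ y → f y ≡ x
injective⇒surjective {suc k} f f-inj x with hits? f x
... | yes hit = hit
... | no miss = contradiction
  (Fin.injective⇒≤ {f = λ y → punchOut {i = x} {f y} (λ e → miss (y , sym e))}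
    (λ {y} {z} e → f-inj (Fin.punchOut-injective (λ e → miss (y , sym e)) (λ e → miss (z , sym e)) e)))
  1+n≰n

intervals⇒LPM : ∀ {n k} {I : IndepPred n} (e : Fin n ↔ Fin n) (a b : Fin k → Fin n) →
  (∀ i → toℕ (a i) ≤ toℕ (b i)) →
  (∀ {i j} → i ≢ j → toℕ (a i) ≤ toℕ (a j) → toℕ (b i) < toℕ (b j)) →
  let A = λ j x → toℕ (a j) ≤ toℕ (Inverse.to e x) × toℕ (Inverse.to e x) ≤ toℕ (b j) in
  (∀ X → (I X → TIndep A X) × (TIndep A X → I X)) → IsLatticePathMatroid I
-- The paths have `n ∸ k` East steps; `go` abstracts the size `n'` so that its equation with `m + k`
-- can be matched with `refl`.
intervals⇒LPM {n} {k} {I} e a b a≤b b-mono equiv = go (n ∸ k) (sym (m∸n+n≡m k≤n)) e a b a≤b b-mono equiv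
  where
  k≤n : k ≤ n
  k≤n = Fin.injective⇒≤ (IntervalFamily.a-injective a b a≤b b-mono)
  go : ∀ m {n'} → n' ≡ m + k → (e : Fin n ↔ Fin n') (a b : Fin k → Fin n') →
    (∀ i → toℕ (a i) ≤ toℕ (b i)) →
    (∀ {i j} → i ≢ j → toℕ (a i) ≤ toℕ (a j) → toℕ (b i) < toℕ (b j)) →
    let A = λ j x → toℕ (a j) ≤ toℕ (Inverse.to e x) × toℕ (Inverse.to e x) ≤ toℕ (b j) in
    (∀ X → (I X → TIndep A X) × (TIndep A X → I X)) → IsLatticePathMatroid I
  go m refl e a b a≤b b-mono equiv =
    m , k , P , Q , path-isLatticePath b b-injective , path-isLatticePath a a-injective ,
    path-neverAbove a b a-injective b-injective a≤b , e , λ Y →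
      (λ IX → TIndep-map {A = A} {A' = NSet m k P Q} (Inverse.from e) rank from-injective rank-injective
        (λ {y} y∈Y → lookup⇒[]= (Inverse.from e y) _ (trans (lookup∘tabulate (lookup Y ∘ Inverse.to e) _)
          (trans (cong (lookup Y) (Inverse.strictlyInverseˡ e y)) ([]=⇒lookup y∈Y))))
        (λ {j} {y} p → ∈⇒NSet (subst (λ z → toℕ (a j) ≤ toℕ z × toℕ z ≤ toℕ (b j))
          (Inverse.strictlyInverseˡ e y) p))
        (proj₁ (equiv _) IX)) ,
      (λ LY → proj₂ (equiv _) (TIndep-map {A = NSet m k P Q} {A' = A} (Inverse.to e) unrank to-injective unrank-injective
        (λ {x} x∈ → lookup⇒[]= _ _ (trans (sym (lookup∘tabulate (lookup Y ∘ Inverse.to e) x)) ([]=⇒lookup x∈)))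
        (λ {j} {x} N → NSet⇒∈ (subst (λ i → NSet m k P Q i (Inverse.to e x)) (sym (rank-unrank j)) N))
        LY))
    where
    open LatticePathPresentation {m} a b a≤b b-mono
    A = λ j x → toℕ (a j) ≤ toℕ (Inverse.to e x) × toℕ (Inverse.to e x) ≤ toℕ (b j)
    unrank : Fin k → Fin k
    unrank j = proj₁ (injective⇒surjective rank rank-injective j)
    rank-unrank : ∀ j → rank (unrank j) ≡ j
    rank-unrank j = proj₂ (injective⇒surjective rank rank-injective j)
    unrank-injective : Injective _≡_ _≡_ unrank
    unrank-injective {i} {j} eq = trans (sym (rank-unrank i)) (trans (cong rank eq) (rank-unrank j))
    to-injective : Injective _≡_ _≡_ (Inverse.to e)
    to-injective {x} {y} eq = trans (sym (Inverse.strictlyInverseʳ e x))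
      (trans (cong (Inverse.from e) eq) (Inverse.strictlyInverseʳ e y))
    from-injective : Injective _≡_ _≡_ (Inverse.from e)
    from-injective {x} {y} eq = trans (sym (Inverse.strictlyInverseˡ e x))
      (trans (cong (Inverse.to e) eq) (Inverse.strictlyInverseˡ e y))

-- Cyclic permutations

module Cyclic {n} (σ : Permutation′ n) (cyclic : IsCyclic σ) where

  iter-+ : ∀ i j x → iter σ (i + j) x ≡ iter σ i (iter σ j x)
  iter-+ zero j x = refl
  iter-+ (suc i) j x = cong (σ ⟨$⟩ʳ_) (iter-+ i j x)

  iter-injective : ∀ i {x y} → iter σ i x ≡ iter σ i y → x ≡ y
  iter-injective zero e = e
  iter-injective (suc i) {x} {y} e = iter-injective i
    (trans (sym (inverseˡ σ)) (trans (cong (σ ⟨$⟩ˡ_) e) (inverseˡ σ)))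

  iter-* : ∀ {d o} → iter σ d o ≡ o → ∀ q → iter σ (q * d) o ≡ o
  iter-* period zero = refl
  iter-* {d} {o} period (suc q) =
    trans (iter-+ d (q * d) o) (trans (cong (iter σ d) (iter-* period q)) period)

  iter-% : ∀ {d o} .{{_ : NonZero d}} → iter σ d o ≡ o → ∀ i → iter σ (i % d) o ≡ iter σ i o
  iter-% {d} {o} period i = sym (trans (cong (λ z → iter σ z o) (m≡m%n+[m/n]*n i d))
    (trans (iter-+ (i % d) (i / d * d) o) (cong (iter σ (i % d)) (iter-* period (i / d)))))

  -- Every element is an iterate of `o`, and the exponent matters only modulo `d`.
  period⇒n≤ : ∀ {d o} .{{_ : NonZero d}} → iter σ d o ≡ o → n ≤ d
  period⇒n≤ {d} {o} period = Fin.injective⇒≤ {f = λ x → fromℕ< (m%n<n (steps x) d)} λ {x} {y} e →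
    trans (sym (reach x)) (trans (cong (λ i → iter σ i o)
      (trans (sym (Fin.toℕ-fromℕ< _)) (trans (cong toℕ e) (Fin.toℕ-fromℕ< _)))) (reach y))
    where
    steps : Fin n → ℕ
    steps x = proj₁ (cyclic o x)
    reach : ∀ x → iter σ (steps x % d) o ≡ x
    reach x = trans (iter-% period (steps x)) (proj₂ (cyclic o x))

  iter-cancel : ∀ {i j o} → i ≤ j → iter σ i o ≡ iter σ j o → iter σ (j ∸ i) o ≡ o
  iter-cancel {i} {j} {o} i≤j e = iter-injective i
    (trans (sym (iter-+ i (j ∸ i) o)) (trans (cong (λ z → iter σ z o) (m+[n∸m]≡n i≤j)) (sym e)))

  -- Two of the `n + 1` iterates with exponents `0` to `n` coincide. This gives a positive period at
  -- most `n`, which `period⇒n≤` forces to equal `n`.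
  iter-n : ∀ o → iter σ n o ≡ o
  iter-n o with Fin.pigeonhole (n<1+n n) (λ i → iter σ (toℕ i) o)
  ... | i , j , i<j , e = subst (λ d → iter σ d o ≡ o) (≤-antisym
      (≤-trans (m∸n≤m (toℕ j) (toℕ i)) (≤-pred (Fin.toℕ<n j)))
      (period⇒n≤ {{>-nonZero (m<n⇒0<n∸m i<j)}} returns)) returns
    where
    returns : iter σ (toℕ j ∸ toℕ i) o ≡ o
    returns = iter-cancel (<⇒≤ i<j) e

  iter-unique : ∀ {i j o} → i < n → j < n → iter σ i o ≡ iter σ j o → i ≡ j
  iter-unique {i} {j} i<n j<n e with <-cmp i j
  ... | tri≈ _ i≡j _ = i≡j
  ... | tri< i<j _ _ = contradiction (≤-<-trans (m∸n≤m j i) j<n)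
    (≤⇒≯ (period⇒n≤ {{>-nonZero (m<n⇒0<n∸m i<j)}} (iter-cancel (<⇒≤ i<j) e)))
  ... | tri> _ _ j<i = contradiction (≤-<-trans (m∸n≤m i j) i<n)
    (≤⇒≯ (period⇒n≤ {{>-nonZero (m<n⇒0<n∸m j<i)}} (iter-cancel (<⇒≤ j<i) (sym e))))

  dist : Fin n → Fin n → ℕ
  dist o x = (proj₁ (cyclic o x) % n) {{Fin.nonZeroIndex o}}

  dist<n : ∀ o x → dist o x < n
  dist<n o x = m%n<n _ n {{Fin.nonZeroIndex o}}

  iter-dist : ∀ o x → iter σ (dist o x) o ≡ x
  iter-dist o x = trans (iter-% {{Fin.nonZeroIndex o}} (iter-n o) _) (proj₂ (cyclic o x))

  dist-unique : ∀ {o x i} → i < n → iter σ i o ≡ x → dist o x ≡ i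
  dist-unique {o} {x} i<n e = iter-unique (dist<n o x) i<n (trans (iter-dist o x) (sym e))

  dist≤ : ∀ {o x} i → iter σ i o ≡ x → dist o x ≤ i
  dist≤ {o} {x} i e with i <? n
  ... | yes i<n = ≤-reflexive (dist-unique i<n e)
  ... | no i≮n = ≤-trans (<⇒≤ (dist<n o x)) (≮⇒≥ i≮n)

  dist-refl : ∀ o → dist o o ≡ 0
  dist-refl o = dist-unique (≤-<-trans z≤n (dist<n o o)) refl

  dist≡0⇒≡ : ∀ {o x} → dist o x ≡ 0 → o ≡ x
  dist≡0⇒≡ {o} {x} e = trans (cong (λ i → iter σ i o) (sym e)) (iter-dist o x)

  iter-dist+dist : ∀ o x y → iter σ (dist x y + dist o x) o ≡ y
  iter-dist+dist o x y = trans (iter-+ (dist x y) (dist o x) o)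
    (trans (cong (iter σ (dist x y)) (iter-dist o x)) (iter-dist x y))

  dist-+ : ∀ o x y → dist o x + dist x y < n → dist o y ≡ dist o x + dist x y
  dist-+ o x y lt = dist-unique lt
    (trans (cong (λ i → iter σ i o) (+-comm (dist o x) (dist x y))) (iter-dist+dist o x y))

  -- An `x` met no later than `y` on the way from `o` lies on the arc from `o` to `y`. `dist-splitʳ`
  -- is the same criterion measured backwards from `y`.
  dist-splitˡ : ∀ o x y → dist o x ≤ dist o y → dist o x + dist x y ≡ dist o y
  dist-splitˡ o x y le = trans (cong (dist o x +_) (dist-unique (≤-<-trans (m∸n≤m (dist o y) (dist o x)) (dist<n o y))
      (trans (cong (iter σ (dist o y ∸ dist o x)) (sym (iter-dist o x)))
        (trans (sym (iter-+ (dist o y ∸ dist o x) (dist o x) o))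
          (trans (cong (λ i → iter σ i o) (m∸n+n≡m le)) (iter-dist o y))))))
    (m+[n∸m]≡n le)

  dist-splitʳ : ∀ o x y → dist x y ≤ dist o y → dist o x + dist x y ≡ dist o y
  dist-splitʳ o x y le = trans (cong (_+ dist x y) (dist-unique (≤-<-trans (m∸n≤m (dist o y) (dist x y)) (dist<n o y))
      (iter-injective (dist x y) (trans (sym (iter-+ (dist x y) (dist o y ∸ dist x y) o))
        (trans (cong (λ i → iter σ i o) (m+[n∸m]≡n le)) (trans (iter-dist o y) (sym (iter-dist x y))))))))
    (m∸n+n≡m le)

  interval-normal : ∀ {X} → IsInterval σ X → Σ (Fin n) λ f → Σ ℕ λ t → t < n ×
    ∀ x → (x ∈ X → dist f x ≤ t) × (dist f x ≤ t → x ∈ X)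
  interval-normal (f , t , mem) with t <? n
  ... | yes t<n = f , t , t<n , λ x →
    (λ p → let i , i≤t , e = proj₁ (mem x) p in ≤-trans (dist≤ i e) i≤t) ,
    λ le → proj₂ (mem x) (dist f x , le , iter-dist f x)
  -- With `t ≥ n` the interval is the whole ground set, which `n - 1` steps already cover.
  ... | no t≮n = f , dist-max , dist-max<n , λ x →
    (λ _ → <⇒≤pred (dist<n f x)) ,
    λ _ → proj₂ (mem x) (dist f x , ≤-trans (<⇒≤ (dist<n f x)) (≮⇒≥ t≮n) , iter-dist f x)
    where
    dist-max : ℕ
    dist-max = pred n
    dist-max<n : dist-max < n
    dist-max<n = ≤-reflexive (suc-pred n {{Fin.nonZeroIndex f}})

-- Multi-path matroids

freeMatroid⇒LPM : ∀ {n} {I : IndepPred n} → (∀ X → I X) → IsLatticePathMatroid I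
-- The presentation is by singletons: left and right ends coincide.
freeMatroid⇒LPM {n} all = intervals⇒LPM (↔-id (Fin n)) id id (λ _ → ≤-refl)
  (λ i≢j le → ≤∧≢⇒< le (i≢j ∘ Fin.toℕ-injective))
  (λ X → (λ _ → TIndep-matching (λ j x → toℕ j ≤ toℕ x × toℕ x ≤ toℕ j) _≡_
                  (λ {x} _ → x , refl) (λ { refl → ≤-refl , ≤-refl }) (λ { refl refl e → e })) , λ _ → all X)

module MultiPath {n k} (σ : Permutation′ n) (cyclic : IsCyclic σ) (B : Fin k → Subset n)
  (interval : ∀ j → IsInterval σ (B j)) (antichain : IsAntichain B) where

  open Cyclic σ cyclic

  Members : Fin k → Fin n → Set
  Members j x = x ∈ B j

  first : Fin k → Fin n
  first j = proj₁ (interval-normal (interval j))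

  len : Fin k → ℕ
  len j = proj₁ (proj₂ (interval-normal (interval j)))

  len<n : ∀ j → len j < n
  len<n j = proj₁ (proj₂ (proj₂ (interval-normal (interval j))))

  ∈⇒dist≤ : ∀ {j x} → x ∈ B j → dist (first j) x ≤ len j
  ∈⇒dist≤ {j} {x} = proj₁ (proj₂ (proj₂ (proj₂ (interval-normal (interval j)))) x)

  dist≤⇒∈ : ∀ {j x} → dist (first j) x ≤ len j → x ∈ B j
  dist≤⇒∈ {j} {x} = proj₂ (proj₂ (proj₂ (proj₂ (interval-normal (interval j)))) x)

  first-∈ : ∀ j → first j ∈ B j
  first-∈ j = dist≤⇒∈ (subst (_≤ len j) (sym (dist-refl (first j))) z≤n)

  ⊆⇒≡ : ∀ {i j} → B i ⊆ B j → i ≡ j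
  ⊆⇒≡ {i} {j} sub = decidable-stable (i Fin.≟ j) (λ i≢j → antichain i j i≢j sub)

  -- Of two intervals with the same first element, the shorter is contained in the longer.
  first-injective : Injective _≡_ _≡_ first
  first-injective {i} {j} e with ≤-total (len i) (len j)
  ... | inj₁ le = ⊆⇒≡ (λ p → dist≤⇒∈
    (≤-trans (subst (λ z → dist z _ ≤ len i) e (∈⇒dist≤ p)) le))
  ... | inj₂ ge = sym (⊆⇒≡ (λ p → dist≤⇒∈
    (≤-trans (subst (λ z → dist z _ ≤ len j) (sym e) (∈⇒dist≤ p)) ge)))

  -- No interval passes from the predecessor of g to g: cutting the cycle there makes every
  -- interval linear.
  module Cut (g : Fin n) (cut : ∀ j → g ∈ B j → g ≡ first j) where

    -- An interval reaching position `n` would come back to `g`, hence start at `g` by `cut`, and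
    -- then have `len j ≥ n`.
    end<n : ∀ j → dist g (first j) + len j < n
    end<n j = ≰⇒> λ n≤ →
      let
        a = dist g (first j)
        n∸a≤len = m≤n+o⇒m∸n≤o n a n≤
        back = trans (cong (iter σ (n ∸ a)) (sym (iter-dist g (first j))))
                 (trans (sym (iter-+ (n ∸ a) a g))
                   (trans (cong (λ i → iter σ i g) (m∸n+n≡m (<⇒≤ (dist<n g (first j))))) (iter-n g)))
        g≡first = cut j (dist≤⇒∈ (≤-trans (dist≤ (n ∸ a) back) n∸a≤len))
        a≡0 = trans (cong (dist g) (sym g≡first)) (dist-refl g)
      in <⇒≱ (len<n j) (subst (λ z → n ≤ z + len j) a≡0 n≤)

    position : Fin n ↔ Fin n
    position = mk↔ₛ′ (λ x → fromℕ< (dist<n g x)) (λ i → iter σ (toℕ i) g)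
      (λ i → Fin.toℕ-injective (trans (Fin.toℕ-fromℕ< _) (dist-unique (Fin.toℕ<n i) refl)))
      (λ x → trans (cong (λ i → iter σ i g) (Fin.toℕ-fromℕ< (dist<n g x))) (iter-dist g x))

    left right : Fin k → Fin n
    left j = fromℕ< (dist<n g (first j))
    right j = fromℕ< (end<n j)

    Between : Fin k → Fin n → Set
    Between j x = toℕ (left j) ≤ toℕ (Inverse.to position x) × toℕ (Inverse.to position x) ≤ toℕ (right j)

    ∈⇒Between : ∀ {j x} → x ∈ B j → Between j x
    ∈⇒Between {j} {x} p
      rewrite Fin.toℕ-fromℕ< (dist<n g (first j)) | Fin.toℕ-fromℕ< (end<n j) | Fin.toℕ-fromℕ< (dist<n g x)
            | dist-+ g (first j) x (≤-<-trans (+-monoʳ-≤ (dist g (first j)) (∈⇒dist≤ p)) (end<n j))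
      = m≤m+n _ _ , +-monoʳ-≤ _ (∈⇒dist≤ p)

    Between⇒∈ : ∀ {j x} → Between j x → x ∈ B j
    Between⇒∈ {j} {x} (l , r)
      rewrite Fin.toℕ-fromℕ< (dist<n g (first j)) | Fin.toℕ-fromℕ< (end<n j) | Fin.toℕ-fromℕ< (dist<n g x)
      = dist≤⇒∈ (+-cancelˡ-≤ (dist g (first j)) _ _
          (subst (_≤ dist g (first j) + len j) (sym (dist-splitˡ g (first j) x l)) r))

    left≤right : ∀ j → toℕ (left j) ≤ toℕ (right j)
    left≤right j = let l , r = ∈⇒Between (first-∈ j) in ≤-trans l r

    right-mono : ∀ {i j} → i ≢ j → toℕ (left i) ≤ toℕ (left j) → toℕ (right i) < toℕ (right j)
    -- Otherwise `B j` would be contained in `B i`.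
    right-mono i≢j le = ≰⇒> λ ge → i≢j (sym (⊆⇒≡ λ p →
      let l , r = ∈⇒Between p in Between⇒∈ (≤-trans le l , ≤-trans r ge)))

    isLPM : {I : IndepPred n} → (∀ X → (I X → TIndepS B X) × (TIndepS B X → I X)) → IsLatticePathMatroid I
    isLPM equiv = intervals⇒LPM position left right left≤right right-mono λ X →
      (λ IX → TIndep-map {A' = Between} id id id id id ∈⇒Between (proj₁ (equiv X) IX)) ,
      (λ T → proj₂ (equiv X) (TIndep-map {A = Between} id id id id id Between⇒∈ T))

  -- The basis of first elements

  firsts : Subset n
  firsts = path first

  firsts-independent : TIndepS B firsts
  firsts-independent = TIndep-matching Members (λ x j → first j ≡ x) (∈-toSubset⁻ (hits? first))
    (λ { {j = j} refl → first-∈ j }) (λ { refl refl e → cong first e })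

  ∣firsts∣ : ∣ firsts ∣ ≡ k
  ∣firsts∣ = ≤-antisym (TIndep⇒∣∣≤ Members firsts-independent)
    (subst (_≤ ∣ firsts ∣) (∣⊤∣≡n k) (∣∣-injective⇒≤ {X = ⊤} {Y = firsts} (λ j _ → first j)
      (λ j _ → ∈-toSubset⁺ (hits? first) (j , refl)) (λ _ _ _ _ → first-injective)))

  -- No independent set is larger than the number `k` of intervals, and `firsts` attains it.
  hasRank-k : ∀ {X} → firsts ⊆ X → HasRank (TIndepS B) X k
  hasRank-k sub = (firsts , sub , firsts-independent , ∣firsts∣) , λ _ _ → TIndep⇒∣∣≤ Members

  -- Spanning circuits in the absence of a cut

  module NoCut (crossing : ∀ g → ∃ λ j → g ∈ B j × g ≢ first j) where

    nearest : ∀ j → ∃ λ i → i ≢ j × ∀ i' → i' ≢ j → dist (first i) (first j) ≤ dist (first i') (first j)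
    nearest j = minimiser (λ i → ¬? (i Fin.≟ j)) (λ i → dist (first i) (first j))
      (let i , _ , ≢ = crossing (first j) in i , ≢ ∘ cong first ∘ sym)

    -- The interval whose first element is the last one met before `first j` in the cyclic order.
    prev : Fin k → Fin k
    prev j = proj₁ (nearest j)

    prev≢ : ∀ j → prev j ≢ j
    prev≢ j = proj₁ (proj₂ (nearest j))

    prev-nearest : ∀ {i j} → i ≢ j → dist (first (prev j)) (first j) ≤ dist (first i) (first j)
    prev-nearest {i} {j} = proj₂ (proj₂ (nearest j)) i

    -- If B (prev j) stopped before first j, it would be contained in any interval crossing first j.
    first-∈-prev : ∀ j → first j ∈ B (prev j)
    first-∈-prev j = decidable-stable (first j ∈? B (prev j)) λ first∉ →
      let
        i , ∈Bi , first≢ = crossing (first j)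
        q = prev j
        split = dist-splitʳ (first i) (first q) (first j) (prev-nearest {i} {j} (first≢ ∘ cong first ∘ sym))
        short = λ {x} (p : x ∈ B q) → <-≤-trans
          (+-monoʳ-< (dist (first i) (first q)) (≤-<-trans (∈⇒dist≤ p) (≰⇒> (first∉ ∘ dist≤⇒∈))))
          (≤-reflexive split)
        q≡i = ⊆⇒≡ {q} {i} λ {x} p → dist≤⇒∈ (≤-trans
          (≤-reflexive (dist-+ (first i) (first q) x (<-trans (short p) (dist<n (first i) (first j)))))
          (≤-trans (<⇒≤ (short p)) (∈⇒dist≤ ∈Bi)))
      in first∉ (subst (λ z → first j ∈ B z) (sym q≡i) ∈Bi)

    -- Suppose `i` and `j` share a predecessor, from which `first i` is met no later than `first j`.
    -- Then `first i` lies between the two, and minimality for `j` makes it equal to the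
    -- predecessor's first element, against `prev≢`.
    prev-injective : Injective _≡_ _≡_ prev
    prev-injective {i} {j} e = decidable-stable (i Fin.≟ j) λ i≢j →
      [ absurd e i≢j , (λ ge → absurd (sym e) (i≢j ∘ sym)
          (subst (λ z → dist (first z) (first j) ≤ dist (first z) (first i)) e ge)) ]′
      (≤-total (dist (first (prev i)) (first i)) (dist (first (prev i)) (first j)))
      where
      absurd : ∀ {i j} → prev i ≡ prev j → i ≢ j →
        ¬ (dist (first (prev i)) (first i) ≤ dist (first (prev i)) (first j))
      absurd {i} {j} e i≢j le = prev≢ i (first-injective (dist≡0⇒≡ (n≤0⇒n≡0
        (+-cancelʳ-≤ (dist (first i) (first j)) _ 0
        (≤-trans (≤-reflexive (dist-splitˡ (first (prev i)) (first i) (first j) le))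
          (subst (λ z → dist (first z) (first j) ≤ dist (first i) (first j)) (sym e) (prev-nearest i≢j)))))))

    module SpanningCircuit (y : Fin n) (y∉firsts : ∀ j → first j ≢ y) where

      member? : Decidable (λ x → x ≡ y ⊎ ∃ λ j → first j ≡ x)
      member? x = (x Fin.≟ y) ⊎-dec hits? first x

      C : Subset n
      C = toSubset member?

      y∈C : y ∈ C
      y∈C = ∈-toSubset⁺ member? (inj₁ refl)

      firsts⊆C : firsts ⊆ C
      firsts⊆C p = ∈-toSubset⁺ member? (inj₂ (∈-toSubset⁻ (hits? first) p))

      -- Delete first o. The elements from there up to first j₀, where y ∈ B j₀, are shifted to
      -- the preceding interval, which frees B j₀ for y.
      module Delete (o : Fin k) where

        j₀ : Fin k
        j₀ = proj₁ (crossing y)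

        pos : Fin k → ℕ
        pos j = dist (first o) (first j)

        data Matched : Fin n → Fin k → Set where
          extra : Matched y j₀
          shift : ∀ {j} → j ≢ o → pos j ≤ pos j₀ → Matched (first j) (prev j)
          stay  : ∀ {j} → pos j₀ < pos j → Matched (first j) j

        -- For `j ≢ o`, `first (prev j)` is at least as near to `first j` as `first o` is, so it
        -- lies on the arc from `first o` to `first j`.
        pos-prev : ∀ {i j} → j ≢ o → prev j ≡ i → pos i < pos j
        pos-prev {j = j} j≢o refl = subst (pos (prev j) <_)
          (dist-splitʳ (first o) (first (prev j)) (first j) (prev-nearest (j≢o ∘ sym)))
          (m<m+n _ (n≢0⇒n>0 (prev≢ j ∘ first-injective ∘ dist≡0⇒≡)))

        matched-∈ : ∀ {x j} → Matched x j → x ∈ B j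
        matched-∈ extra = proj₁ (proj₂ (crossing y))
        matched-∈ (shift {j} _ _) = first-∈-prev j
        matched-∈ (stay {j} _) = first-∈ j

        -- Shifted elements use intervals at positions below `pos j₀`, `y` uses `j₀`, and the
        -- elements that stay use positions above; within the shifted ones `prev-injective` decides.
        matched-injective : ∀ {x x' i j} → Matched x i → Matched x' j → i ≡ j → x ≡ x'
        matched-injective extra extra _ = refl
        matched-injective extra (shift j≢o le) e = contradiction (pos-prev j≢o (sym e)) (≤⇒≯ le)
        matched-injective extra (stay gt) e = contradiction gt (<-irrefl (cong pos e))
        matched-injective (shift j≢o le) extra e = contradiction (pos-prev j≢o e) (≤⇒≯ le)
        matched-injective (shift _ _) (shift _ _) e = cong first (prev-injective e)
        matched-injective (shift j≢o le) (stay gt) e = contradiction (<-trans gt (pos-prev j≢o e)) (≤⇒≯ le)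
        matched-injective (stay gt) extra e = contradiction gt (<-irrefl (cong pos (sym e)))
        matched-injective (stay gt) (shift j≢o le) e = contradiction (<-trans gt (pos-prev j≢o (sym e))) (≤⇒≯ le)
        matched-injective (stay _) (stay _) e = cong first e

        independent : ∀ {Y} → Y ⊆ C → first o ∉ Y → TIndepS B Y
        independent {Y} Y⊆C o∉Y = TIndep-matching Members Matched match matched-∈ matched-injective
          where
          match : ∀ {x} → x ∈ Y → ∃ (Matched x)
          match p with ∈-toSubset⁻ member? (Y⊆C p)
          ... | inj₁ refl = _ , extra
          ... | inj₂ (j , refl) with pos j ≤? pos j₀
          ...   | yes le = _ , shift (λ { refl → o∉Y p }) le
          ...   | no ≰ = _ , stay (≰⇒> ≰)

      proper-independent : ∀ Y → Y ⊂ C → TIndepS B Y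
      proper-independent Y (Y⊆C , c , c∈C , c∉Y) with ∈-toSubset⁻ member? c∈C
      ... | inj₂ (o , refl) = Delete.independent o Y⊆C c∉Y
      ... | inj₁ refl = TIndep-⊆ Members Y⊆firsts firsts-independent
        where
        Y⊆firsts : Y ⊆ firsts
        Y⊆firsts p with ∈-toSubset⁻ member? (Y⊆C p)
        ... | inj₁ refl = contradiction p c∉Y
        ... | inj₂ hit = ∈-toSubset⁺ (hits? first) hit

      dependent : ¬ TIndepS B C
      -- `C` has more than `k` elements, as it contains `firsts` and also `y`.
      dependent T = <⇒≱ (p⊂q⇒∣p∣<∣q∣ (firsts⊆C , y , y∈C , λ p →
          let j , e = ∈-toSubset⁻ (hits? first) p in y∉firsts j e))
        (≤-trans (TIndep⇒∣∣≤ Members T) (≤-reflexive (sym ∣firsts∣)))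

      isSpanningCircuit : IsSpanningCircuit (TIndepS B) C
      isSpanningCircuit = (dependent , proper-independent) , λ x →
        k , hasRank-k firsts⊆C , hasRank-k (λ p → p⊆p∪q ⁅ x ⁆ (firsts⊆C p))

-- Assembling the theorem

IsSpanningCircuit-resp : ∀ {n} {I J : IndepPred n} → (∀ X → (I X → J X) × (J X → I X)) →
  ∀ {C} → IsSpanningCircuit J C → IsSpanningCircuit I C
IsSpanningCircuit-resp equiv ((dep , min) , span) =
  ((dep ∘ proj₁ (equiv _)) , λ Y Y⊂C → proj₂ (equiv Y) (min Y Y⊂C)) ,
  λ x → let ρ , r , r' = span x in ρ , rank r , rank r'
  where
  rank : ∀ {X ρ} → HasRank _ X ρ → HasRank _ X ρ
  rank ((Y , Y⊆X , JY , e) , max) =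
    (Y , Y⊆X , proj₂ (equiv Y) JY , e) , λ Z Z⊆X IZ → max Z Z⊆X (proj₁ (equiv Z) IZ)

theorem6p1 : ∀ (n : ℕ) (I : IndepPred n) → IsMultiPath I → ¬ IsLatticePathMatroid I →
    (∃ λ (C : Subset n) → IsSpanningCircuit I C) ×
    (∀ (x : Fin n) → ∃ λ (C : Subset n) → x ∈ C × IsSpanningCircuit I C)
theorem6p1 n I (k , B , (σ , cyclic , interval , antichain) , equiv) ¬LPM =
  (let C , _ , circ = through (proj₁ outside-first) in C , circ) , through
  where
  open MultiPath σ cyclic B interval antichain

  crossing : ∀ g → ∃ λ j → g ∈ B j × g ≢ first j
  crossing g = decidable-stable (Fin.any? λ j → (g ∈? B j) ×-dec ¬? (g Fin.≟ first j)) λ none →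
    ¬LPM (Cut.isLPM g (λ j g∈ → decidable-stable (g Fin.≟ first j) λ g≢ → none (j , g∈ , g≢)) equiv)

  open NoCut crossing

  -- If every element were a first element, the ground set would be independent and the matroid
  -- free.
  outside-first : ∃ λ y → ¬ ∃ λ j → first j ≡ y
  outside-first = Fin.¬∀⟶∃¬ n _ (hits? first) λ all → ¬LPM (freeMatroid⇒LPM λ X →
    proj₂ (equiv X) (TIndep-⊆ Members (λ {x} _ → ∈-toSubset⁺ (hits? first) (all x)) firsts-independent))

  circuit : ∀ y → ¬ (∃ λ j → first j ≡ y) → ∃ λ C → firsts ⊆ C × y ∈ C × IsSpanningCircuit I C
  circuit y y∉ = C , firsts⊆C , y∈C , IsSpanningCircuit-resp equiv isSpanningCircuit
    where open SpanningCircuit y (λ j e → y∉ (j , e))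

  through : ∀ x → ∃ λ C → x ∈ C × IsSpanningCircuit I C
  through x with hits? first x
  ... | no x∉ = let C , _ , x∈C , circ = circuit x x∉ in C , x∈C , circ
  -- Each of these circuits contains all first elements, so any choice of `y` serves.
  ... | yes hit = let C , ⊆C , _ , circ = circuit _ (proj₂ outside-first) in
    C , ⊆C (∈-toSubset⁺ (hits? first) hit) , circ
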